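{- Let $q$ be a prime power, $n\ge1$, and $E\subseteq\mathbb{F}_q^n$. If $|E|\gg q^{\frac n2+\frac14}$ (i.e. $|E|\ge Cq^{\frac n2+\frac14}$ for a suitable sufficiently large constant $C$), then \[|[E,E,0][E,E,0]|\gg q\,|[E,E,0]|.\]
   Context: The Heisenberg group $H_n(\mathbb{F}_q)$ consists of the matrices \[[\mathbf{x},\mathbf{y},z]=\begin{bmatrix}1&\mathbf{x}&z\\ \mathbf{0}&I_n&\mathbf{y}^t\\ 0&\mathbf{0}&1\end{bmatrix},\qquad \mathbf{x},\mathbf{y}\in \mathbb{F}_q^n,\ z\in \mathbb{F}_q,\] with matrix multiplication, so $[\mathbf{x},\mathbf{y},z][\mathbf{x}',\mathbf{y}',z']=[\mathbf{x}+\mathbf{x}',\mathbf{y}+\mathbf{y}',z+z'+\mathbf{x}\cdot\mathbf{y}']$. For $E\subseteq\mathbb{F}_q^n$, $[E,E,0]=\{[\mathbf{x},\mathbf{y},0]:\mathbf{x},\mathbf{y}\in E\}$ and $[E,E,0][E,E,0]=\{mm':m,m'\in[E,E,0]\}$. $X\ll Y$ (equivalently $Y\gg X$) means $X\le CY$ for a constant $C>0$ independent of $q$ and $E$. -}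

module Defs where

open import Data.Nat using (ℕ; zero; suc)
open import Data.Fin using (Fin)
open import Data.Fin.Properties using () renaming (_≟_ to _≟F_)
open import Data.Vec using (Vec; []; _∷_; zipWith; foldr)
open import Data.Vec.Properties using (≡-dec)
open import Data.List using (List; []; _∷_; concatMap; map; length; filterᵇ)
open import Data.Bool.ListAction using (any)
open import Data.Bool using (Bool; true; false; _∧_)
open import Data.Product using (_×_; _,_; ∃)
open import Relation.Nullary.Decidable using (⌊_⌋)
open import Relation.Binary.PropositionalEquality using (_≡_; _≢_)
open import Algebra.Structures using (IsCommutativeRing)

record FiniteField (q : ℕ) : Set where
  field
    _+_ _*_ : Fin q → Fin q → Fin q
    -_ : Fin q → Fin q
    0# 1# : Fin q
    isCommutativeRing : IsCommutativeRing _≡_ _+_ _*_ -_ 0# 1#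
    0≢1 : 0# ≢ 1#
    inverse : ∀ x → x ≢ 0# → ∃ λ y → x * y ≡ 1#

allFinList : (q : ℕ) → List (Fin q)
allFinList q = Data.List.allFin q

allVecs : (q n : ℕ) → List (Vec (Fin q) n)
allVecs q zero = [] ∷ []
allVecs q (suc n) = concatMap (λ a → map (a ∷_) (allVecs q n)) (allFinList q)

SubsetV : ℕ → ℕ → Set
SubsetV q n = Vec (Fin q) n → Bool

card : ∀ {q n} → SubsetV q n → ℕ
card {q} {n} E = length (filterᵇ E (allVecs q n))

-- Heisenberg group elements [x, y, z]
H : ℕ → ℕ → Set
H q n = Vec (Fin q) n × Vec (Fin q) n × Fin q

allH : (q n : ℕ) → List (H q n)
allH q n = concatMap (λ x → concatMap (λ y → map (λ z → (x , y , z)) (allFinList q)) (allVecs q n)) (allVecs q n)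

module _ {q : ℕ} (F : FiniteField q) where
  open FiniteField F

  dot : ∀ {n} → Vec (Fin q) n → Vec (Fin q) n → Fin q
  dot x y = foldr _ _+_ 0# (zipWith _*_ x y)

  hmul : ∀ {n} → H q n → H q n → H q n
  hmul (x , y , z) (x' , y' , z') = (zipWith _+_ x x' , zipWith _+_ y y' , (z + z') + dot x y')

  eqH : ∀ {n} → H q n → H q n → Bool
  eqH (x , y , z) (x' , y' , z') = ⌊ ≡-dec _≟F_ x x' ⌋ ∧ (⌊ ≡-dec _≟F_ y y' ⌋ ∧ ⌊ z ≟F z' ⌋)

  inEE0 : ∀ {n} → SubsetV q n → H q n → Bool
  inEE0 E (x , y , z) = E x ∧ (E y ∧ ⌊ z ≟F 0# ⌋)

  inEE0EE0 : ∀ {n} → SubsetV q n → H q n → Bool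
  inEE0EE0 {n} E h =
    any (λ m → inEE0 E m ∧ any (λ m' → inEE0 E m' ∧ eqH (hmul m m') h) (allH q n)) (allH q n)

  cardEE0 : ∀ {n} → SubsetV q n → ℕ
  cardEE0 {n} E = length (filterᵇ (inEE0 E) (allH q n))

  cardEE0EE0 : ∀ {n} → SubsetV q n → ℕ
  cardEE0EE0 {n} E = length (filterᵇ (inEE0EE0 E) (allH q n))

{-# OPTIONS --safe #-}
module Submission where

open import Defs
open import Data.Nat using (ℕ; _+_; _*_; _^_; _≤_; _≥_; zero; suc; z≤n; s≤s)
open import Data.Nat.Properties
open import Data.Nat.ListAction using (sum)
open import Data.Nat.ListAction.Properties using (sum-++)
open import Data.Nat.Tactic.RingSolver using (solve-∀)
open import Data.Bool using (Bool; true; false; if_then_else_; T; _∧_)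
open import Data.Bool.Properties using (T-∧; T-≡; T?)
open import Data.Fin using (Fin; zero; suc)
open import Data.Fin.Properties using () renaming (_≟_ to _≟F_)
open import Data.List using (List; []; _∷_; _++_; map; length; concatMap; cartesianProduct; filterᵇ; allFin; tabulate)
open import Data.List.Properties using (map-++; map-∘; map-cong; length-map; length-++; length-tabulate; map-tabulate)
open import Data.List.Membership.Propositional using (_∈_; lose)
open import Data.List.Membership.Propositional.Properties using (∈-filter⁻; ∈-cartesianProduct⁻)
open import Data.List.Relation.Unary.Any using (here; there)
open import Data.List.Relation.Unary.Any.Properties using (any⁺)
open import Data.List.Relation.Binary.Sublist.Propositional using (_⊆_; []; _∷_; _∷ʳ_)
open import Data.List.Relation.Binary.Sublist.Propositional.Properties using (map⁺; ++⁺; ++⁺ˡ; filter-⊆)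
open import Data.Product using (∃; _×_; _,_; proj₁; proj₂)
import Data.Product.Properties as Product
open import Data.Vec using (Vec; []; _∷_; foldr; zipWith)
import Data.Vec.Properties as Vec
open import Function using (_∘_; Equivalence)
open import Level using (0ℓ)
open import Relation.Binary using (DecidableEquality)
open import Relation.Binary.PropositionalEquality hiding (J)
open import Relation.Nullary using (Dec; yes; no; does; contradiction)
open import Relation.Nullary.Decidable using (isYes≗does; _×-dec_; fromWitness)
open import Algebra.Bundles using (CommutativeMonoid; CommutativeRing)
import Algebra.Properties.Group as GroupProperties
import Algebra.Properties.CommutativeSemigroup as CommutativeSemigroupProperties

-- By Cauchy-Schwarz, |E|⁸ is at most the size of the product set times the
-- number T of solutions in E of
--   x + x′ = u + u′,  y + y′ = v + v′,  x · y′ = u · v′.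
-- Pairing the first equation with v′ and the second with x, and adding, gives
--   (x , v′) · (v , u′) = (x , v′) · (y , x′)
-- in dimension 2n, which no longer involves u and y′; since these two are
-- determined by the other six vectors, T is at most the number of w = (x , v′),
-- p, p′ in E² with w · p = w · p′.  For each w in F_q²ⁿ the number of pairs p, p′ is
-- at least |E|⁴ / q, so the total excess over w ∈ E² is at most the excess over
-- all w, a second moment that is computed by counting points on hyperplanes.
-- This gives q T ≤ |E|⁶ + q²ⁿ⁺¹ |E|² ≤ 2 |E|⁶.

private variable
  A B K : Set
  P Q : Set

-- Finite sums

∑ : List A → (A → ℕ) → ℕ
∑ xs f = sum (map f xs)

infixr 8 ∑
syntax ∑ xs (λ x → e) = ∑[ x ∈ xs ] e

∑-cong : {f g : A → ℕ} → (∀ x → f x ≡ g x) → ∀ xs → ∑ xs f ≡ ∑ xs g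
∑-cong f≗g xs = cong sum (map-cong f≗g xs)

∑-mono-∈ : {f g : A → ℕ} (xs : List A) → (∀ {x} → x ∈ xs → f x ≤ g x) → ∑ xs f ≤ ∑ xs g
∑-mono-∈ []       f≤g = z≤n
∑-mono-∈ (x ∷ xs) f≤g = +-mono-≤ (f≤g (here refl)) (∑-mono-∈ xs (f≤g ∘ there))

∑-mono : {f g : A → ℕ} (xs : List A) → (∀ x → f x ≤ g x) → ∑ xs f ≤ ∑ xs g
∑-mono xs f≤g = ∑-mono-∈ xs (λ {x} _ → f≤g x)

∑-const : (xs : List A) (c : ℕ) → ∑[ x ∈ xs ] c ≡ length xs * c
∑-const []       c = refl
∑-const (_ ∷ xs) c = cong (c +_) (∑-const xs c)

∑-+ : (xs : List A) (f g : A → ℕ) → ∑[ x ∈ xs ] (f x + g x) ≡ ∑ xs f + ∑ xs g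
∑-+ []       f g = refl
∑-+ (x ∷ xs) f g = trans (cong (f x + g x +_) (∑-+ xs f g)) (interchange (f x) (g x) (∑ xs f) (∑ xs g))
  where
  interchange : ∀ a b c d → a + b + (c + d) ≡ a + c + (b + d)
  interchange = solve-∀

∑-*ˡ : (xs : List A) (c : ℕ) (f : A → ℕ) → ∑[ x ∈ xs ] (c * f x) ≡ c * ∑ xs f
∑-*ˡ []       c f = sym (*-zeroʳ c)
∑-*ˡ (x ∷ xs) c f = trans (cong (c * f x +_) (∑-*ˡ xs c f)) (sym (*-distribˡ-+ c (f x) (∑ xs f)))

∑-*ʳ : (xs : List A) (c : ℕ) (f : A → ℕ) → ∑[ x ∈ xs ] (f x * c) ≡ ∑ xs f * c
∑-*ʳ xs c f = trans (∑-cong (λ x → *-comm (f x) c) xs) (trans (∑-*ˡ xs c f) (*-comm c _))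

∑-* : (xs : List A) (ys : List B) (f : A → ℕ) (g : B → ℕ) →
      ∑[ x ∈ xs ] ∑[ y ∈ ys ] (f x * g y) ≡ ∑ xs f * ∑ ys g
∑-* xs ys f g = trans (∑-cong (λ x → ∑-*ˡ ys (f x) g) xs) (∑-*ʳ xs (∑ ys g) f)

∑-swap : (xs : List A) (ys : List B) (f : A → B → ℕ) →
         ∑[ x ∈ xs ] ∑[ y ∈ ys ] f x y ≡ ∑[ y ∈ ys ] ∑[ x ∈ xs ] f x y
∑-swap []       ys f = sym (trans (∑-const ys 0) (*-zeroʳ (length ys)))
∑-swap (x ∷ xs) ys f = trans (cong (∑ ys (f x) +_) (∑-swap xs ys f))
  (sym (∑-+ ys (f x) (λ y → ∑[ x ∈ xs ] f x y)))

∑-map : (g : A → B) (xs : List A) (f : B → ℕ) → ∑ (map g xs) f ≡ ∑ xs (f ∘ g)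
∑-map g xs f = cong sum (sym (map-∘ xs))

∑-++ : (xs ys : List A) (f : A → ℕ) → ∑ (xs ++ ys) f ≡ ∑ xs f + ∑ ys f
∑-++ xs ys f = trans (cong sum (map-++ f xs ys)) (sum-++ (map f xs) (map f ys))

∑-concatMap : (g : A → List B) (xs : List A) (f : B → ℕ) →
              ∑ (concatMap g xs) f ≡ ∑[ x ∈ xs ] ∑ (g x) f
∑-concatMap g []       f = refl
∑-concatMap g (x ∷ xs) f = trans (∑-++ (g x) (concatMap g xs) f) (cong (∑ (g x) f +_) (∑-concatMap g xs f))

∑-× : (xs : List A) (ys : List B) (f : A × B → ℕ) →
      ∑ (cartesianProduct xs ys) f ≡ ∑[ x ∈ xs ] ∑[ y ∈ ys ] f (x , y)
∑-× []       ys f = refl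
∑-× (x ∷ xs) ys f = trans (∑-++ (map (x ,_) ys) _ f) (cong₂ _+_ (∑-map (x ,_) ys f) (∑-× xs ys f))

-- Summing the pointwise bound gives `k * ∑ xs f ≤ k * m`, and a positive `k` cancels. It adds up
-- the q slices of a hyperplane.
∑-average : ∀ {k m} (xs : List A) (f : A → ℕ) → length xs ≡ k → (∀ x → k * f x ≤ m) → ∑ xs f ≤ m
∑-average {k = zero}      []  f refl bound = z≤n
∑-average {k = suc k} {m} xs f len  bound = *-cancelˡ-≤ (suc k) (begin
  suc k * ∑ xs f             ≡⟨ ∑-*ˡ xs (suc k) f ⟨
  ∑[ x ∈ xs ] (suc k * f x)  ≤⟨ ∑-mono xs bound ⟩
  ∑[ x ∈ xs ] m              ≡⟨ ∑-const xs m ⟩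
  length xs * m              ≡⟨ cong (_* m) len ⟩
  suc k * m                  ∎)
  where open ≤-Reasoning

length-cartesianProduct : (xs : List A) (ys : List B) → length (cartesianProduct xs ys) ≡ length xs * length ys
length-cartesianProduct []       ys = refl
length-cartesianProduct (x ∷ xs) ys = trans (length-++ (map (x ,_) ys))
  (cong₂ _+_ (length-map (x ,_) ys) (length-cartesianProduct xs ys))

∑-⊆ : {xs ys : List A} → xs ⊆ ys → (f : A → ℕ) → ∑ xs f ≤ ∑ ys f
∑-⊆ []          f = z≤n
∑-⊆ (y ∷ʳ xs⊆)  f = ≤-trans (∑-⊆ xs⊆ f) (m≤n+m _ (f y))
∑-⊆ (refl ∷ xs⊆) f = +-monoʳ-≤ _ (∑-⊆ xs⊆ f)

-- The excess of f over a lower bound m is larger on ys than on xs, with both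
-- sides moved so that no subtraction occurs.
∑-excess-⊆ : {xs ys : List A} → xs ⊆ ys → (f : A → ℕ) (m : ℕ) → (∀ y → m ≤ f y) →
             ∑ xs f + length ys * m ≤ ∑ ys f + length xs * m
∑-excess-⊆ []           f m m≤f = z≤n
∑-excess-⊆ {xs = xs} {_ ∷ ys} (y ∷ʳ xs⊆) f m m≤f = begin
  ∑ xs f + (m + length ys * m)     ≡⟨ left-comm (∑ xs f) m (length ys * m) ⟩
  m + (∑ xs f + length ys * m)     ≤⟨ +-mono-≤ (m≤f y) (∑-excess-⊆ xs⊆ f m m≤f) ⟩
  f y + (∑ ys f + length xs * m)   ≡⟨ +-assoc (f y) (∑ ys f) _ ⟨
  f y + ∑ ys f + length xs * m     ∎
  where
  open ≤-Reasoning
  left-comm : ∀ a b c → a + (b + c) ≡ b + (a + c)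
  left-comm = solve-∀
∑-excess-⊆ {xs = x ∷ xs} {_ ∷ ys} (refl ∷ xs⊆) f m m≤f = begin
  f x + ∑ xs f + (m + length ys * m)     ≡⟨ regroup (f x) (∑ xs f) m (length ys * m) ⟩
  f x + m + (∑ xs f + length ys * m)     ≤⟨ +-monoʳ-≤ (f x + m) (∑-excess-⊆ xs⊆ f m m≤f) ⟩
  f x + m + (∑ ys f + length xs * m)     ≡⟨ regroup (f x) (∑ ys f) m (length xs * m) ⟨
  f x + ∑ ys f + (m + length xs * m)     ∎
  where
  open ≤-Reasoning
  regroup : ∀ a b c d → a + b + (c + d) ≡ a + c + (b + d)
  regroup = solve-∀

cartesianProduct-⊆ : {xs xs′ : List A} {ys ys′ : List B} → xs ⊆ xs′ → ys ⊆ ys′ →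
                     cartesianProduct xs ys ⊆ cartesianProduct xs′ ys′
cartesianProduct-⊆ []             ys⊆ = []
cartesianProduct-⊆ (x ∷ʳ xs⊆)     ys⊆ = ++⁺ˡ (map (x ,_) _) (cartesianProduct-⊆ xs⊆ ys⊆)
cartesianProduct-⊆ (_∷_ {x} refl xs⊆) ys⊆ = ++⁺ (map⁺ (x ,_) ys⊆) (cartesianProduct-⊆ xs⊆ ys⊆)

-- This is (m - n)² ≥ 0 without subtraction: raising both arguments by one adds 2m + 2n + 2 to each
-- side, and the left side vanishes once an argument is zero.
2*m*n≤m²+n² : ∀ m n → 2 * (m * n) ≤ m * m + n * n
2*m*n≤m²+n² zero    n       = z≤n
2*m*n≤m²+n² (suc m) zero    = ≤-trans (≤-reflexive (cong (2 *_) (*-zeroʳ m))) z≤n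
2*m*n≤m²+n² (suc m) (suc n) = begin
  2 * (suc m * suc n)                  ≡⟨ lhs m n ⟩
  2 * (m * n) + (2 * m + 2 * n + 2)    ≤⟨ +-monoˡ-≤ _ (2*m*n≤m²+n² m n) ⟩
  m * m + n * n + (2 * m + 2 * n + 2)  ≡⟨ rhs m n ⟨
  suc m * suc m + suc n * suc n        ∎
  where
  open ≤-Reasoning
  lhs : ∀ m n → 2 * (suc m * suc n) ≡ 2 * (m * n) + (2 * m + 2 * n + 2)
  lhs = solve-∀
  rhs : ∀ m n → suc m * suc m + suc n * suc n ≡ m * m + n * n + (2 * m + 2 * n + 2)
  rhs = solve-∀

-- Sum 2ab ≤ a² + b² over all pairs of values of `f`: the left side is twice the squared sum, and on
-- the right each of the two squares contributes `length xs * S`.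
cauchy-schwarz : (xs : List A) (f : A → ℕ) → ∑ xs f * ∑ xs f ≤ length xs * ∑[ x ∈ xs ] (f x * f x)
cauchy-schwarz xs f = *-cancelˡ-≤ 2 (begin
  2 * (∑ xs f * ∑ xs f)                           ≡⟨ cong (2 *_) (∑-* xs xs f f) ⟨
  2 * (∑[ x ∈ xs ] ∑[ y ∈ xs ] (f x * f y))       ≡⟨ ∑-*ˡ xs 2 _ ⟨
  ∑[ x ∈ xs ] (2 * (∑[ y ∈ xs ] (f x * f y)))     ≡⟨ ∑-cong (λ x → sym (∑-*ˡ xs 2 _)) xs ⟩
  ∑[ x ∈ xs ] ∑[ y ∈ xs ] (2 * (f x * f y))       ≤⟨ ∑-mono xs (λ x → ∑-mono xs (λ y → 2*m*n≤m²+n² (f x) (f y))) ⟩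
  ∑[ x ∈ xs ] ∑[ y ∈ xs ] (f x * f x + f y * f y) ≡⟨ ∑-cong (λ x → ∑-+ xs _ _) xs ⟩
  ∑[ x ∈ xs ] (∑[ y ∈ xs ] (f x * f x) + S)       ≡⟨ ∑-cong (λ x → cong (_+ S) (∑-const xs (f x * f x))) xs ⟩
  ∑[ x ∈ xs ] (length xs * (f x * f x) + S)       ≡⟨ ∑-+ xs _ _ ⟩
  ∑[ x ∈ xs ] (length xs * (f x * f x)) + (∑[ x ∈ xs ] S) ≡⟨ cong₂ _+_ (∑-*ˡ xs (length xs) _) (∑-const xs S) ⟩
  length xs * S + length xs * S                   ≡⟨ cong (length xs * S +_) (+-identityʳ _) ⟨
  2 * (length xs * S)                             ∎)
  where
  open ≤-Reasoning
  S : ℕ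
  S = ∑[ x ∈ xs ] (f x * f x)

-- Indicators and enumerations

𝟙 : Bool → ℕ
𝟙 b = if b then 1 else 0

𝟙-∧ : ∀ a b → 𝟙 (a ∧ b) ≡ 𝟙 a * 𝟙 b
𝟙-∧ true  b = sym (+-identityʳ (𝟙 b))
𝟙-∧ false b = refl

-- Turns an implication between conditions into an inequality between counts, once both sides are
-- summed.
𝟙-mono : (d : Dec P) (e : Dec Q) → (P → Q) → 𝟙 (does d) ≤ 𝟙 (does e)
𝟙-mono (no _)  e       f = z≤n
𝟙-mono (yes p) (yes _) f = ≤-refl
𝟙-mono (yes p) (no ¬q) f = contradiction (f p) ¬q

𝟙-cong : (d : Dec P) (e : Dec Q) → (P → Q) → (Q → P) → 𝟙 (does d) ≡ 𝟙 (does e)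
𝟙-cong d e f g = ≤-antisym (𝟙-mono d e f) (𝟙-mono e d g)

T-∧⁺ : ∀ {a b} → T a → T b → T (a ∧ b)
T-∧⁺ p r = Equivalence.from T-∧ (p , r)

𝟙≤1 : ∀ b → 𝟙 b ≤ 1
𝟙≤1 true  = ≤-refl
𝟙≤1 false = z≤n

∑-filterᵇ : (p : A → Bool) (xs : List A) (f : A → ℕ) →
            ∑ (filterᵇ p xs) f ≡ ∑[ x ∈ xs ] (𝟙 (p x) * f x)
∑-filterᵇ p []       f = refl
∑-filterᵇ p (x ∷ xs) f with p x
... | true  = cong₂ _+_ (sym (+-identityʳ (f x))) (∑-filterᵇ p xs f)
... | false = ∑-filterᵇ p xs f

length-filterᵇ : (p : A → Bool) (xs : List A) → length (filterᵇ p xs) ≡ ∑[ x ∈ xs ] 𝟙 (p x)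
length-filterᵇ p []       = refl
length-filterᵇ p (x ∷ xs) with p x
... | true  = cong suc (length-filterᵇ p xs)
... | false = length-filterᵇ p xs

filterᵇ-⊆ : (p : A → Bool) (xs : List A) → filterᵇ p xs ⊆ xs
filterᵇ-⊆ p = filter-⊆ (T? ∘ p)

-- Multiplicities in lists and collisions of maps.

module _ (_≟_ : DecidableEquality K) where

  -- Multiplicity is a sum of indicators so that it can be interchanged with other sums.
  occurrences : K → List K → ℕ
  occurrences k ks = ∑[ k′ ∈ ks ] 𝟙 (does (k ≟ k′))

  occurs⇒∈ : ∀ k ks → 1 ≤ occurrences k ks → k ∈ ks
  occurs⇒∈ k (k′ ∷ ks) occ with k ≟ k′
  ... | yes k≡k′ = here k≡k′
  ... | no _     = there (occurs⇒∈ k ks occ)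

  occurrences-filterᵇ : (p : K → Bool) → ∀ k ks → T (p k) → occurrences k (filterᵇ p ks) ≡ occurrences k ks
  occurrences-filterᵇ p k ks pk = trans (∑-filterᵇ p ks _) (∑-cong select ks)
    where
    select : ∀ k′ → 𝟙 (p k′) * 𝟙 (does (k ≟ k′)) ≡ 𝟙 (does (k ≟ k′))
    select k′ with k ≟ k′
    ... | no _     = *-zeroʳ (𝟙 (p k′))
    ... | yes refl = cong (λ b → 𝟙 b * 1) (Equivalence.to T-≡ pk)

  Nonrepeating Enumerates : List K → Set
  Nonrepeating ks = ∀ k → occurrences k ks ≤ 1
  Enumerates   ks = ∀ k → occurrences k ks ≡ 1

  ⊆-nonrepeating : ∀ {ks ls} → Enumerates ls → ks ⊆ ls → Nonrepeating ks
  ⊆-nonrepeating enum ks⊆ k = ≤-trans (∑-⊆ ks⊆ _) (≤-reflexive (enum k))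

  -- The second moment of the fibre sizes of `f`, diagonal pairs included. For the Heisenberg
  -- product on quadruples it is the number T of solutions.
  collisions : List A → (A → K) → ℕ
  collisions xs f = ∑[ x ∈ xs ] ∑[ y ∈ xs ] 𝟙 (does (f x ≟ f y))

  -- Cauchy-Schwarz for the fibre sizes over `ks`. As each value of `f` is listed exactly once, the
  -- fibres exhaust `xs` and no collision is counted twice. It is applied both with the product set
  -- and with the field as `ks`.
  ∣xs∣²≤∣ks∣*collisions : (xs : List A) (f : A → K) (ks : List K) →
    (∀ {x} → x ∈ xs → occurrences (f x) ks ≡ 1) → length xs * length xs ≤ length ks * collisions xs f
  ∣xs∣²≤∣ks∣*collisions xs f ks once = begin
    length xs * length xs                      ≤⟨ *-mono-≤ total total ⟩
    ∑ ks fibre * ∑ ks fibre                    ≤⟨ cauchy-schwarz ks fibre ⟩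
    length ks * (∑[ k ∈ ks ] (fibre k * fibre k)) ≤⟨ *-monoʳ-≤ (length ks) pairs ⟩
    length ks * collisions xs f                ∎
    where
    open ≤-Reasoning
    δ : K → K → ℕ
    δ k k′ = 𝟙 (does (k ≟ k′))
    fibre : K → ℕ
    fibre k = ∑[ x ∈ xs ] δ (f x) k
    total : length xs ≤ ∑ ks fibre
    total = begin
      length xs                     ≡⟨ *-identityʳ (length xs) ⟨
      length xs * 1                 ≡⟨ ∑-const xs 1 ⟨
      ∑[ x ∈ xs ] 1                 ≤⟨ ∑-mono-∈ xs (λ x∈xs → ≤-reflexive (sym (once x∈xs))) ⟩
      ∑[ x ∈ xs ] ∑[ k ∈ ks ] δ (f x) k ≡⟨ ∑-swap xs ks _ ⟩
      ∑ ks fibre                    ∎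
    δ-trans : ∀ k l m → δ k m * δ l m ≤ δ k m * δ k l
    δ-trans k l m with k ≟ m
    ... | no _     = z≤n
    ... | yes refl = +-monoˡ-≤ 0 (𝟙-mono (l ≟ k) (k ≟ l) sym)
    pairs : ∑[ k ∈ ks ] (fibre k * fibre k) ≤ collisions xs f
    pairs = begin
      ∑[ k ∈ ks ] (fibre k * fibre k)
        ≡⟨ ∑-cong (λ k → ∑-* xs xs _ _) ks ⟨
      ∑[ k ∈ ks ] ∑[ x ∈ xs ] ∑[ y ∈ xs ] (δ (f x) k * δ (f y) k)
        -- Two elements over the same k collide with each other. Now k remains only in the first
        -- factor, whose sum over `ks` is one.
        ≤⟨ ∑-mono ks (λ k → ∑-mono xs (λ x → ∑-mono xs (λ y → δ-trans (f x) (f y) k))) ⟩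
      ∑[ k ∈ ks ] ∑[ x ∈ xs ] ∑[ y ∈ xs ] (δ (f x) k * δ (f x) (f y))
        ≡⟨ ∑-cong (λ k → ∑-cong (λ x → ∑-*ˡ xs (δ (f x) k) _) xs) ks ⟩
      ∑[ k ∈ ks ] ∑[ x ∈ xs ] (δ (f x) k * ∑[ y ∈ xs ] δ (f x) (f y))
        ≡⟨ ∑-swap ks xs _ ⟩
      ∑[ x ∈ xs ] ∑[ k ∈ ks ] (δ (f x) k * ∑[ y ∈ xs ] δ (f x) (f y))
        ≡⟨ ∑-cong (λ x → ∑-*ʳ ks _ _) xs ⟩
      ∑[ x ∈ xs ] (occurrences (f x) ks * ∑[ y ∈ xs ] δ (f x) (f y))
        ≤⟨ ∑-mono-∈ xs (λ x∈xs → ≤-reflexive (trans (cong (_* ∑ xs _) (once x∈xs)) (*-identityˡ _))) ⟩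
      collisions xs f ∎

-- Enumerations of the field, of vectors and of the Heisenberg group.

allFin-enumerates : ∀ q → Enumerates _≟F_ (allFin q)
allFin-enumerates (suc q) k = trans (cong (𝟙 (does (k ≟F zero)) +_) shift) (split k)
  where
  shift : sum (map (λ j → 𝟙 (does (k ≟F j))) (tabulate suc)) ≡ ∑[ j ∈ allFin q ] 𝟙 (does (k ≟F suc j))
  shift = trans (cong (λ js → ∑ js (λ j → 𝟙 (does (k ≟F j)))) (sym (map-tabulate {n = q} (λ j → j) Fin.suc)))
    (∑-map Fin.suc (allFin q) _)
  split : ∀ k → 𝟙 (does (k ≟F zero)) + ∑[ j ∈ allFin q ] 𝟙 (does (k ≟F suc j)) ≡ 1
  split zero    = cong suc (trans (∑-const (allFin q) 0) (*-zeroʳ (length (allFin q))))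
  split (suc k) = trans (∑-cong (λ j → 𝟙-cong (suc k ≟F suc j) (k ≟F j) (λ { refl → refl }) (cong suc)) (allFin q)) (allFin-enumerates q k)

infix 4 _≟V_ _≟H_

_≟V_ : ∀ {q n} → DecidableEquality (Vec (Fin q) n)
_≟V_ = Vec.≡-dec _≟F_

_≟H_ : ∀ {q n} → DecidableEquality (H q n)
_≟H_ = Product.≡-dec _≟V_ (Product.≡-dec _≟V_ _≟F_)

_≟V²_ : ∀ {q n} → DecidableEquality (Vec (Fin q) n × Vec (Fin q) n)
_≟V²_ = Product.≡-dec _≟V_ _≟V_

-- Equality of nonempty vectors is the conjunction of independent conditions on head and tail, so
-- multiplicities multiply.
allVecs-enumerates : ∀ q n → Enumerates _≟V_ (allVecs q n)
allVecs-enumerates q zero    []      = refl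
allVecs-enumerates q (suc n) (x ∷ v) = begin
  ∑[ w ∈ allVecs q (suc n) ] 𝟙 (does (x ∷ v ≟V w))
    ≡⟨ ∑-concatMap _ (allFin q) _ ⟩
  ∑[ a ∈ allFin q ] ∑[ w ∈ map (a ∷_) (allVecs q n) ] 𝟙 (does (x ∷ v ≟V w))
    ≡⟨ ∑-cong (λ a → ∑-map (a ∷_) (allVecs q n) _) (allFin q) ⟩
  ∑[ a ∈ allFin q ] ∑[ w ∈ allVecs q n ] 𝟙 (does (x ∷ v ≟V a ∷ w))
    ≡⟨ ∑-cong (λ a → ∑-cong (λ w → split a w) (allVecs q n)) (allFin q) ⟩
  ∑[ a ∈ allFin q ] ∑[ w ∈ allVecs q n ] (𝟙 (does (x ≟F a)) * 𝟙 (does (v ≟V w)))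
    ≡⟨ ∑-* (allFin q) (allVecs q n) _ _ ⟩
  occurrences _≟F_ x (allFin q) * occurrences _≟V_ v (allVecs q n)
    ≡⟨ cong₂ _*_ (allFin-enumerates q x) (allVecs-enumerates q n v) ⟩
  1 ∎
  where
  open ≡-Reasoning
  split : ∀ a w → 𝟙 (does (x ∷ v ≟V a ∷ w)) ≡ 𝟙 (does (x ≟F a)) * 𝟙 (does (v ≟V w))
  split a w = trans (𝟙-cong (x ∷ v ≟V a ∷ w) ((x ≟F a) ×-dec (v ≟V w)) Vec.∷-injective (λ (p , r) → cong₂ _∷_ p r))
    (𝟙-∧ (does (x ≟F a)) (does (v ≟V w)))

length-allVecs : ∀ q n → length (allVecs q n) ≡ q ^ n
length-allVecs q zero    = refl
length-allVecs q (suc n) = begin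
  length (allVecs q (suc n))                                 ≡⟨ length-∑ (allVecs q (suc n)) ⟩
  ∑[ w ∈ allVecs q (suc n) ] 1                               ≡⟨ ∑-concatMap _ (allFin q) _ ⟩
  ∑[ a ∈ allFin q ] ∑[ w ∈ map (a ∷_) (allVecs q n) ] 1      ≡⟨ ∑-cong (λ a → ∑-map (a ∷_) (allVecs q n) _) (allFin q) ⟩
  ∑[ a ∈ allFin q ] ∑[ w ∈ allVecs q n ] 1                   ≡⟨ ∑-const (allFin q) _ ⟩
  length (allFin q) * (∑[ w ∈ allVecs q n ] 1)               ≡⟨ cong₂ _*_ (length-tabulate {n = q} _) (sym (length-∑ (allVecs q n))) ⟩
  q * length (allVecs q n)                                   ≡⟨ cong (q *_) (length-allVecs q n) ⟩
  q * q ^ n                                                  ∎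
  where
  open ≡-Reasoning
  length-∑ : (xs : List A) → length xs ≡ ∑[ x ∈ xs ] 1
  length-∑ xs = sym (trans (∑-const xs 1) (*-identityʳ (length xs)))

length-allVecs² : ∀ q n → length (cartesianProduct (allVecs q n) (allVecs q n)) ≡ q ^ n * q ^ n
length-allVecs² q n = trans (length-cartesianProduct (allVecs q n) (allVecs q n))
  (cong₂ _*_ (length-allVecs q n) (length-allVecs q n))

∑-allH : ∀ q n (f : H q n → ℕ) →
         ∑ (allH q n) f ≡ ∑[ x ∈ allVecs q n ] ∑[ y ∈ allVecs q n ] ∑[ z ∈ allFin q ] f (x , y , z)
∑-allH q n f = trans (∑-concatMap _ V f) (∑-cong (λ x → trans (∑-concatMap _ V f)
  (∑-cong (λ y → ∑-map (λ z → x , y , z) (allFin q) f) V)) V)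
  where V = allVecs q n

-- Serves indicators that split over the three coordinates: equality with a fixed group element, and
-- membership in [E, E, 0].
∑-allH-* : ∀ q n (f g : Vec (Fin q) n → ℕ) (h : Fin q → ℕ) →
           ∑[ (x , y , z) ∈ allH q n ] (f x * (g y * h z)) ≡ ∑ (allVecs q n) f * (∑ (allVecs q n) g * ∑ (allFin q) h)
∑-allH-* q n f g h = begin
  ∑[ (x , y , z) ∈ allH q n ] (f x * (g y * h z))                          ≡⟨ ∑-allH q n _ ⟩
  ∑[ x ∈ V ] ∑[ y ∈ V ] ∑[ z ∈ allFin q ] (f x * (g y * h z))              ≡⟨ ∑-cong (λ x → ∑-cong (λ y → ∑-*ˡ (allFin q) (f x) _) V) V ⟩
  ∑[ x ∈ V ] ∑[ y ∈ V ] (f x * ∑[ z ∈ allFin q ] (g y * h z))              ≡⟨ ∑-* V V f _ ⟩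
  ∑ V f * ∑[ y ∈ V ] ∑[ z ∈ allFin q ] (g y * h z)                         ≡⟨ cong (∑ V f *_) (∑-* V (allFin q) g h) ⟩
  ∑ V f * (∑ V g * ∑ (allFin q) h)                                         ∎
  where
  open ≡-Reasoning
  V = allVecs q n

allH-enumerates : ∀ q n → Enumerates _≟H_ (allH q n)
allH-enumerates q n (x , y , z) = begin
  ∑[ h ∈ allH q n ] 𝟙 (does ((x , y , z) ≟H h))
    ≡⟨ ∑-cong split (allH q n) ⟩
  ∑[ (x′ , y′ , z′) ∈ allH q n ] (𝟙 (does (x ≟V x′)) * (𝟙 (does (y ≟V y′)) * 𝟙 (does (z ≟F z′))))
    ≡⟨ ∑-allH-* q n _ _ _ ⟩
  occurrences _≟V_ x (allVecs q n) * (occurrences _≟V_ y (allVecs q n) * occurrences _≟F_ z (allFin q))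
    ≡⟨ cong₂ _*_ (allVecs-enumerates q n x) (cong₂ _*_ (allVecs-enumerates q n y) (allFin-enumerates q z)) ⟩
  1 ∎
  where
  open ≡-Reasoning
  split : ∀ ((x′ , y′ , z′) : H q n) → 𝟙 (does ((x , y , z) ≟H (x′ , y′ , z′)))
        ≡ 𝟙 (does (x ≟V x′)) * (𝟙 (does (y ≟V y′)) * 𝟙 (does (z ≟F z′)))
  split (x′ , y′ , z′) = trans
    (𝟙-cong ((x , y , z) ≟H (x′ , y′ , z′)) ((x ≟V x′) ×-dec ((y ≟V y′) ×-dec (z ≟F z′)))
      (λ { refl → refl , refl , refl }) (λ { (refl , refl , refl) → refl }))
    (trans (𝟙-∧ (does (x ≟V x′)) _) (cong (𝟙 (does (x ≟V x′)) *_) (𝟙-∧ (does (y ≟V y′)) _)))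

∈-allH : ∀ {q n} (h : H q n) → h ∈ allH q n
∈-allH {q} {n} h = occurs⇒∈ _≟H_ h (allH q n) (≤-reflexive (sym (allH-enumerates q n h)))

×-nonrepeating : ∀ {q n} (xs ys : List (Vec (Fin q) n)) → Nonrepeating _≟V_ xs → Nonrepeating _≟V_ ys →
                 Nonrepeating _≟V²_ (cartesianProduct xs ys)
×-nonrepeating xs ys nx ny (x , y) = begin
  ∑[ p ∈ cartesianProduct xs ys ] 𝟙 (does ((x , y) ≟V² p))            ≡⟨ ∑-× xs ys _ ⟩
  ∑[ x′ ∈ xs ] ∑[ y′ ∈ ys ] 𝟙 (does ((x , y) ≟V² (x′ , y′)))          ≡⟨ ∑-cong (λ x′ → ∑-cong (split x′) ys) xs ⟩
  ∑[ x′ ∈ xs ] ∑[ y′ ∈ ys ] (𝟙 (does (x ≟V x′)) * 𝟙 (does (y ≟V y′))) ≡⟨ ∑-* xs ys _ _ ⟩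
  occurrences _≟V_ x xs * occurrences _≟V_ y ys                        ≤⟨ *-mono-≤ (nx x) (ny y) ⟩
  1                                                                    ∎
  where
  open ≤-Reasoning
  split : ∀ x′ y′ → 𝟙 (does ((x , y) ≟V² (x′ , y′))) ≡ 𝟙 (does (x ≟V x′)) * 𝟙 (does (y ≟V y′))
  split x′ y′ = trans (𝟙-cong ((x , y) ≟V² (x′ , y′)) ((x ≟V x′) ×-dec (y ≟V y′))
    (λ { refl → refl , refl }) (λ { (refl , refl) → refl })) (𝟙-∧ (does (x ≟V x′)) _)

-- Counting over a finite field

module _ {q : ℕ} (F : FiniteField q) where
  open FiniteField F using (0#; 1#; inverse; isCommutativeRing)
    renaming (_+_ to infixl 6 _⊕_; _*_ to infixl 7 _⊗_; -_ to infix 8 ⊖_)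

  commutativeRing : CommutativeRing 0ℓ 0ℓ
  commutativeRing = record { isCommutativeRing = isCommutativeRing }

  private
    module R = CommutativeRing commutativeRing
  open GroupProperties R.+-group using (//-rightDividesˡ; //-rightDividesʳ; ∙-cancelˡ; ∙-cancelʳ; x∙y⁻¹≈ε⇒x≈y)
  open CommutativeSemigroupProperties (CommutativeMonoid.commutativeSemigroup R.+-commutativeMonoid)
    using (interchange; xy∙z≈y∙xz)

  -- Vector arithmetic and the dot product.

  private
    infixl 7 _·_
    _·_ : ∀ {n} → Vec (Fin q) n → Vec (Fin q) n → Fin q
    _·_ = dot F
    infixl 6 _⊞_ _⊟_
    _⊞_ _⊟_ : ∀ {n} → Vec (Fin q) n → Vec (Fin q) n → Vec (Fin q) n
    _⊞_ = zipWith _⊕_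
    _⊟_ = zipWith (λ a b → a ⊕ ⊖ b)

  ·-comm : ∀ {n} (x y : Vec (Fin q) n) → x · y ≡ y · x
  ·-comm x y = cong (foldr _ _⊕_ 0#) (Vec.zipWith-comm R.*-comm x y)

  ·-distribˡ : ∀ {n} (x y z : Vec (Fin q) n) → x · (y ⊞ z) ≡ x · y ⊕ x · z
  ·-distribˡ []      []      []      = sym (R.+-identityˡ 0#)
  ·-distribˡ (a ∷ x) (b ∷ y) (c ∷ z) =
    trans (cong₂ _⊕_ (R.distribˡ a b c) (·-distribˡ x y z)) (interchange (a ⊗ b) (a ⊗ c) (x · y) (x · z))

  x⊞y⊟y : ∀ {n} (x y : Vec (Fin q) n) → x ⊞ y ⊟ y ≡ x
  x⊞y⊟y []      []      = refl
  x⊞y⊟y (a ∷ x) (b ∷ y) = cong₂ _∷_ (//-rightDividesʳ b a) (x⊞y⊟y x y)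

  ⊞-comm : ∀ {n} (x y : Vec (Fin q) n) → x ⊞ y ≡ y ⊞ x
  ⊞-comm = Vec.zipWith-comm R.+-comm

  -- The equation reads z (a - b) = s - r, so (s - r) / (a - b) is the only candidate; uniqueness is
  -- what an upper bound on the number of solutions requires.
  affine-solution : ∀ {a b} → a ≢ b → ∀ r s → ∃ λ z₀ → ∀ z → z ⊗ a ⊕ r ≡ z ⊗ b ⊕ s → z₀ ≡ z
  affine-solution {a} {b} a≢b r s with inverse (a ⊕ ⊖ b) (a≢b ∘ x∙y⁻¹≈ε⇒x≈y a b)
  ... | i , [a-b]i≡1 = (s ⊕ ⊖ r) ⊗ i , unique
    where
    open ≡-Reasoning
    unique : ∀ z → z ⊗ a ⊕ r ≡ z ⊗ b ⊕ s → (s ⊕ ⊖ r) ⊗ i ≡ z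
    unique z eq = begin
      (s ⊕ ⊖ r) ⊗ i             ≡⟨ cong (_⊗ i) z[a-b]≡s-r ⟨
      z ⊗ (a ⊕ ⊖ b) ⊗ i         ≡⟨ R.*-assoc z (a ⊕ ⊖ b) i ⟩
      z ⊗ ((a ⊕ ⊖ b) ⊗ i)       ≡⟨ cong (z ⊗_) [a-b]i≡1 ⟩
      z ⊗ 1#                    ≡⟨ R.*-identityʳ z ⟩
      z                         ∎
      where
      -- After adding z b + r, the left side becomes z a + r and the right side z b + s, which `eq`
      -- identifies.
      z[a-b]≡s-r : z ⊗ (a ⊕ ⊖ b) ≡ s ⊕ ⊖ r
      z[a-b]≡s-r = ∙-cancelʳ (z ⊗ b ⊕ r) _ _ (begin
        z ⊗ (a ⊕ ⊖ b) ⊕ (z ⊗ b ⊕ r)   ≡⟨ R.+-assoc _ (z ⊗ b) r ⟨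
        z ⊗ (a ⊕ ⊖ b) ⊕ z ⊗ b ⊕ r     ≡⟨ cong (_⊕ r) (R.distribˡ z (a ⊕ ⊖ b) b) ⟨
        z ⊗ (a ⊕ ⊖ b ⊕ b) ⊕ r         ≡⟨ cong (λ c → z ⊗ c ⊕ r) (//-rightDividesˡ b a) ⟩
        z ⊗ a ⊕ r                     ≡⟨ eq ⟩
        z ⊗ b ⊕ s                     ≡⟨ cong (z ⊗ b ⊕_) (//-rightDividesˡ r s) ⟨
        z ⊗ b ⊕ (s ⊕ ⊖ r ⊕ r)         ≡⟨ R.+-assoc (z ⊗ b) _ r ⟨
        z ⊗ b ⊕ (s ⊕ ⊖ r) ⊕ r         ≡⟨ xy∙z≈y∙xz (z ⊗ b) (s ⊕ ⊖ r) r ⟩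
        (s ⊕ ⊖ r) ⊕ (z ⊗ b ⊕ r)       ∎)

  affine-solutions≤1 : ∀ {a b} → a ≢ b → ∀ r s →
    ∑[ z ∈ allFin q ] 𝟙 (does (z ⊗ a ⊕ r ≟F z ⊗ b ⊕ s)) ≤ 1
  affine-solutions≤1 {a} {b} a≢b r s with affine-solution a≢b r s
  ... | z₀ , unique = ≤-trans
    (∑-mono (allFin q) (λ z → 𝟙-mono (z ⊗ a ⊕ r ≟F z ⊗ b ⊕ s) (z₀ ≟F z) (unique z)))
    (≤-reflexive (allFin-enumerates q z₀))

  -- Induction on the dimension. If the tails of `a` and `b` agree, the heads differ, and each tail
  -- of x admits at most one first coordinate. Otherwise the first coordinate is fixed and absorbed
  -- into the constants, which is why `r` and `s` are arbitrary.
  hyperplane-size : ∀ {n} {a b : Vec (Fin q) n} → a ≢ b → ∀ r s →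
    q * ∑[ x ∈ allVecs q n ] 𝟙 (does (x · a ⊕ r ≟F x · b ⊕ s)) ≤ q ^ n
  hyperplane-size {a = []}    {[]}    a≢b r s = contradiction refl a≢b
  hyperplane-size {suc n} {a ∷ as} {b ∷ bs} a≢b r s = begin
    q * ∑[ x ∈ allVecs q (suc n) ] 𝟙 (does (x · (a ∷ as) ⊕ r ≟F x · (b ∷ bs) ⊕ s))
      ≡⟨ cong (q *_) (trans (∑-concatMap _ (allFin q) _) (∑-cong (λ z → ∑-map (z ∷_) (allVecs q n) _) (allFin q))) ⟩
    q * ∑[ z ∈ allFin q ] ∑[ x ∈ allVecs q n ] 𝟙 (does (z ⊗ a ⊕ x · as ⊕ r ≟F z ⊗ b ⊕ x · bs ⊕ s))
      ≤⟨ *-monoʳ-≤ q (bound (as ≟V bs)) ⟩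
    q * q ^ n ∎
    where
    open ≤-Reasoning
    bound : Dec (as ≡ bs) →
      ∑[ z ∈ allFin q ] ∑[ x ∈ allVecs q n ] 𝟙 (does (z ⊗ a ⊕ x · as ⊕ r ≟F z ⊗ b ⊕ x · bs ⊕ s)) ≤ q ^ n
    bound (yes refl) = begin
      ∑[ z ∈ allFin q ] ∑[ x ∈ allVecs q n ] 𝟙 (does (z ⊗ a ⊕ x · as ⊕ r ≟F z ⊗ b ⊕ x · bs ⊕ s))
        ≡⟨ ∑-swap (allFin q) (allVecs q n) _ ⟩
      ∑[ x ∈ allVecs q n ] ∑[ z ∈ allFin q ] 𝟙 (does (z ⊗ a ⊕ x · as ⊕ r ≟F z ⊗ b ⊕ x · bs ⊕ s))
        ≤⟨ ∑-mono (allVecs q n) (λ x → ≤-trans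
             (∑-mono (allFin q) (λ z → 𝟙-mono (_ ≟F _) (z ⊗ a ⊕ (x · as ⊕ r) ≟F z ⊗ b ⊕ (x · bs ⊕ s))
               (λ eq → trans (sym (R.+-assoc _ _ _)) (trans eq (R.+-assoc _ _ _)))))
             (affine-solutions≤1 (λ a≡b → a≢b (cong (_∷ as) a≡b)) (x · as ⊕ r) (x · bs ⊕ s))) ⟩
      ∑[ x ∈ allVecs q n ] 1         ≡⟨ ∑-const (allVecs q n) 1 ⟩
      length (allVecs q n) * 1       ≡⟨ *-identityʳ _ ⟩
      length (allVecs q n)           ≡⟨ length-allVecs q n ⟩
      q ^ n                          ∎
    -- Each of the q slices has at most q ^ n / q points by induction, so together they have at most
    -- q ^ n.
    bound (no as≢bs) = ∑-average (allFin q) _ (length-tabulate {n = q} _) (λ z → begin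
      q * ∑[ x ∈ allVecs q n ] 𝟙 (does (z ⊗ a ⊕ x · as ⊕ r ≟F z ⊗ b ⊕ x · bs ⊕ s))
        ≤⟨ *-monoʳ-≤ q (∑-mono (allVecs q n) (λ x → 𝟙-mono (_ ≟F _) (x · as ⊕ (z ⊗ a ⊕ r) ≟F x · bs ⊕ (z ⊗ b ⊕ s))
             (λ eq → trans (sym (xy∙z≈y∙xz _ _ _)) (trans eq (xy∙z≈y∙xz _ _ _))))) ⟩
      q * ∑[ x ∈ allVecs q n ] 𝟙 (does (x · as ⊕ (z ⊗ a ⊕ r) ≟F x · bs ⊕ (z ⊗ b ⊕ s)))
        ≤⟨ hyperplane-size as≢bs (z ⊗ a ⊕ r) (z ⊗ b ⊕ s) ⟩
      q ^ n ∎)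

  -- Hyperplanes and collisions in dimension 2n.

  private
    infix 7 _⋆_
    -- The dot product of F_q²ⁿ, with each vector kept as a pair of halves.
    _⋆_ : ∀ {n} → Vec (Fin q) n × Vec (Fin q) n → Vec (Fin q) n × Vec (Fin q) n → Fin q
    (x , v) ⋆ (a , b) = x · a ⊕ v · b

  -- `p` and `p′` differ in some half. Fixing the opposite half of w, in one of q ^ n ways, leaves a
  -- hyperplane in dimension n.
  hyperplane-size² : ∀ {n} {p p′ : Vec (Fin q) n × Vec (Fin q) n} → p ≢ p′ →
    q * ∑[ w ∈ cartesianProduct (allVecs q n) (allVecs q n) ] 𝟙 (does (w ⋆ p ≟F w ⋆ p′)) ≤ q ^ n * q ^ n
  hyperplane-size² {n} {a , b} {a′ , b′} p≢p′ = begin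
    q * ∑[ w ∈ cartesianProduct V V ] 𝟙 (does (w ⋆ (a , b) ≟F w ⋆ (a′ , b′)))
      ≡⟨ cong (q *_) (∑-× V V _) ⟩
    q * ∑[ x ∈ V ] ∑[ v ∈ V ] 𝟙 (does (x · a ⊕ v · b ≟F x · a′ ⊕ v · b′))
      ≤⟨ bound (a ≟V a′) ⟩
    q ^ n * q ^ n ∎
    where
    open ≤-Reasoning
    V = allVecs q n
    slice : (f : Vec (Fin q) n → Vec (Fin q) n → ℕ) → (∀ x → q * ∑[ v ∈ V ] f x v ≤ q ^ n) →
            q * ∑[ x ∈ V ] ∑[ v ∈ V ] f x v ≤ q ^ n * q ^ n
    slice f f≤ = begin
      q * ∑[ x ∈ V ] ∑[ v ∈ V ] f x v    ≡⟨ ∑-*ˡ V q _ ⟨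
      ∑[ x ∈ V ] (q * ∑[ v ∈ V ] f x v)  ≤⟨ ∑-mono V f≤ ⟩
      ∑[ x ∈ V ] (q ^ n)                 ≡⟨ ∑-const V (q ^ n) ⟩
      length V * q ^ n                   ≡⟨ cong (_* q ^ n) (length-allVecs q n) ⟩
      q ^ n * q ^ n                      ∎
    bound : Dec (a ≡ a′) → q * ∑[ x ∈ V ] ∑[ v ∈ V ] 𝟙 (does (x · a ⊕ v · b ≟F x · a′ ⊕ v · b′)) ≤ q ^ n * q ^ n
    bound (no a≢a′) = ≤-trans (≤-reflexive (cong (q *_) (∑-swap V V _)))
      (slice _ (λ v → hyperplane-size a≢a′ (v · b) (v · b′)))
    bound (yes refl) = slice _ (λ x → ≤-trans
      (*-monoʳ-≤ q (∑-mono V (λ v → 𝟙-mono (_ ≟F _) (v · b ⊕ x · a ≟F v · b′ ⊕ x · a)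
        (λ eq → trans (R.+-comm _ _) (trans eq (R.+-comm _ _))))))
      (hyperplane-size (λ b≡b′ → p≢p′ (cong (a ,_) b≡b′)) (x · a) (x · a)))

  -- Exchange the sums and count, for each pair p, p′, the w with w ⋆ p = w ⋆ p′. Distinct points
  -- give a hyperplane; the diagonal, which has at most `length ps` pairs, accounts for the summand
  -- `q`.
  pencil-collisions : ∀ {n} (ps : List (Vec (Fin q) n × Vec (Fin q) n)) → Nonrepeating _≟V²_ ps →
    q * ∑[ w ∈ cartesianProduct (allVecs q n) (allVecs q n) ] collisions _≟F_ ps (w ⋆_)
      ≤ length ps * ((length ps + q) * (q ^ n * q ^ n))
  pencil-collisions {n} ps nonrep = begin
    q * ∑[ w ∈ W ] ∑[ p ∈ ps ] ∑[ p′ ∈ ps ] δ w p p′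
      ≡⟨ cong (q *_) (trans (∑-swap W ps _) (∑-cong (λ p → ∑-swap W ps _) ps)) ⟩
    q * ∑[ p ∈ ps ] ∑[ p′ ∈ ps ] ∑[ w ∈ W ] δ w p p′
      ≡⟨ trans (∑-cong (λ p → ∑-*ˡ ps q _) ps) (∑-*ˡ ps q _) ⟨
    ∑[ p ∈ ps ] ∑[ p′ ∈ ps ] (q * ∑[ w ∈ W ] δ w p p′)
      ≤⟨ ∑-mono ps (λ p → ∑-mono ps (λ p′ → pair p p′ (p ≟V² p′))) ⟩
    ∑[ p ∈ ps ] ∑[ p′ ∈ ps ] ((1 + 𝟙 (does (p ≟V² p′)) * q) * M)
      ≤⟨ ∑-mono ps row ⟩
    ∑[ p ∈ ps ] ((length ps + q) * M)
      ≡⟨ ∑-const ps _ ⟩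
    length ps * ((length ps + q) * M) ∎
    where
    open ≤-Reasoning
    W = cartesianProduct (allVecs q n) (allVecs q n)
    M = q ^ n * q ^ n
    δ : ∀ (w p p′ : Vec (Fin q) n × Vec (Fin q) n) → ℕ
    δ w p p′ = 𝟙 (does (w ⋆ p ≟F w ⋆ p′))
    pair : ∀ p p′ (d : Dec (p ≡ p′)) → q * ∑[ w ∈ W ] δ w p p′ ≤ (1 + 𝟙 (does d) * q) * M
    pair p p′ (no p≢p′) = ≤-trans (hyperplane-size² p≢p′) (≤-reflexive (sym (*-identityˡ M)))
    -- Here every w counts, giving q M. Relaxing this to (1 + q) M lets one formula cover both
    -- cases.
    pair p p′ (yes _)   = begin
      q * ∑[ w ∈ W ] δ w p p′     ≤⟨ *-monoʳ-≤ q (∑-mono W (λ w → 𝟙≤1 (does (w ⋆ p ≟F w ⋆ p′)))) ⟩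
      q * ∑[ w ∈ W ] 1            ≡⟨ cong (q *_) (trans (∑-const W 1) (trans (*-identityʳ (length W)) (length-allVecs² q n))) ⟩
      q * M                       ≤⟨ *-monoˡ-≤ M (m≤n+m q 1) ⟩
      (1 + q) * M                 ≡⟨ cong (λ c → (1 + c) * M) (*-identityˡ q) ⟨
      (1 + 1 * q) * M             ∎
    row : ∀ p → ∑[ p′ ∈ ps ] ((1 + 𝟙 (does (p ≟V² p′)) * q) * M) ≤ (length ps + q) * M
    row p = begin
      ∑[ p′ ∈ ps ] ((1 + 𝟙 (does (p ≟V² p′)) * q) * M)
        ≡⟨ ∑-*ʳ ps M _ ⟩
      (∑[ p′ ∈ ps ] (1 + 𝟙 (does (p ≟V² p′)) * q)) * M
        ≡⟨ cong (_* M) (trans (∑-+ ps _ _) (cong₂ _+_ (trans (∑-const ps 1) (*-identityʳ (length ps)))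
             (∑-*ʳ ps q (λ p′ → 𝟙 (does (p ≟V² p′)))))) ⟩
      (length ps + occurrences _≟V²_ p ps * q) * M
        ≤⟨ *-monoˡ-≤ M (+-monoʳ-≤ (length ps) (≤-trans (*-monoˡ-≤ q (nonrep p)) (≤-reflexive (*-identityˡ q)))) ⟩
      (length ps + q) * M ∎

  -- Every w has at least ∣ps∣²/q collisions, so the excess over that average may
  -- be summed over all w instead of w ∈ ps.
  restricted-pencil-collisions : ∀ {n} (ps : List (Vec (Fin q) n × Vec (Fin q) n)) → Nonrepeating _≟V²_ ps →
    ps ⊆ cartesianProduct (allVecs q n) (allVecs q n) →
    q * ∑[ w ∈ ps ] collisions _≟F_ ps (w ⋆_)
      ≤ q * (q ^ n * q ^ n) * length ps + length ps * (length ps * length ps)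
  restricted-pencil-collisions {n} ps nonrep ps⊆ = +-cancelʳ-≤ (M * (l * l)) _ _ (begin
    q * ∑ ps S + M * (l * l)
      ≡⟨ cong₂ _+_ (sym (∑-*ˡ ps q S)) (cong (_* (l * l)) (sym (length-allVecs² q n))) ⟩
    ∑[ w ∈ ps ] (q * S w) + length W * (l * l)
      ≤⟨ ∑-excess-⊆ ps⊆ (λ w → q * S w) (l * l) least ⟩
    ∑[ w ∈ W ] (q * S w) + l * (l * l)
      ≤⟨ +-monoˡ-≤ _ (≤-trans (≤-reflexive (∑-*ˡ W q S)) (pencil-collisions ps nonrep)) ⟩
    -- The main term l² M of the second moment equals the lower bound l² summed over all M choices
    -- of w, so it cancels. What remains is the diagonal term q M l and the baseline l³ over `ps`.
    l * ((l + q) * M) + l * (l * l)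
      ≡⟨ rearrange l q M ⟩
    q * M * l + l * (l * l) + M * (l * l) ∎)
    where
    open ≤-Reasoning
    W = cartesianProduct (allVecs q n) (allVecs q n)
    M = q ^ n * q ^ n
    l = length ps
    S : Vec (Fin q) n × Vec (Fin q) n → ℕ
    S w = collisions _≟F_ ps (w ⋆_)
    least : ∀ w → l * l ≤ q * S w
    least w = ≤-trans (∣xs∣²≤∣ks∣*collisions _≟F_ ps (w ⋆_) (allFin q) (λ {p} _ → allFin-enumerates q (w ⋆ p)))
      (≤-reflexive (cong (_* S w) (length-tabulate {n = q} _)))
    rearrange : ∀ l q M → l * ((l + q) * M) + l * (l * l) ≡ q * M * l + l * (l * l) + M * (l * l)
    rearrange = solve-∀

  -- In the sum of `first` and `second`, the terms x · v′ and u · v′ occur on both sides and cancel,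
  -- leaving an equation without u and y′.
  product-collision : ∀ {n} {x x′ y y′ u u′ v v′ : Vec (Fin q) n} → x ⊞ x′ ≡ u ⊞ u′ → y ⊞ y′ ≡ v ⊞ v′ →
    x · y′ ≡ u · v′ → (x , v′) ⋆ (v , u′) ≡ (x , v′) ⋆ (y , x′)
  product-collision {x = x} {x′} {y} {y′} {u} {u′} {v} {v′} xx′≡uu′ yy′≡vv′ xy′≡uv′ =
    ∙-cancelʳ (x · v′ ⊕ u · v′) _ _ (begin
      (x · v ⊕ v′ · u′) ⊕ (x · v′ ⊕ u · v′)  ≡⟨ interchange _ _ _ _ ⟩
      (x · v ⊕ x · v′) ⊕ (v′ · u′ ⊕ u · v′)  ≡⟨ cong₂ _⊕_ first second ⟩
      (x · y ⊕ u · v′) ⊕ (x · v′ ⊕ v′ · x′)  ≡⟨ cong ((x · y ⊕ u · v′) ⊕_) (R.+-comm _ _) ⟩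
      (x · y ⊕ u · v′) ⊕ (v′ · x′ ⊕ x · v′)  ≡⟨ interchange _ _ _ _ ⟩
      (x · y ⊕ v′ · x′) ⊕ (u · v′ ⊕ x · v′)  ≡⟨ cong ((x · y ⊕ v′ · x′) ⊕_) (R.+-comm _ _) ⟩
      (x · y ⊕ v′ · x′) ⊕ (x · v′ ⊕ u · v′)  ∎)
    where
    open ≡-Reasoning
    first : x · v ⊕ x · v′ ≡ x · y ⊕ u · v′
    first = begin
      x · v ⊕ x · v′  ≡⟨ ·-distribˡ x v v′ ⟨
      x · (v ⊞ v′)    ≡⟨ cong (x ·_) yy′≡vv′ ⟨
      x · (y ⊞ y′)    ≡⟨ ·-distribˡ x y y′ ⟩
      x · y ⊕ x · y′  ≡⟨ cong (x · y ⊕_) xy′≡uv′ ⟩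
      x · y ⊕ u · v′  ∎
    second : v′ · u′ ⊕ u · v′ ≡ x · v′ ⊕ v′ · x′
    second = begin
      v′ · u′ ⊕ u · v′  ≡⟨ cong (v′ · u′ ⊕_) (·-comm u v′) ⟩
      v′ · u′ ⊕ v′ · u  ≡⟨ R.+-comm _ _ ⟩
      v′ · u ⊕ v′ · u′  ≡⟨ ·-distribˡ v′ u u′ ⟨
      v′ · (u ⊞ u′)     ≡⟨ cong (v′ ·_) xx′≡uu′ ⟨
      v′ · (x ⊞ x′)     ≡⟨ ·-distribˡ v′ x x′ ⟩
      v′ · x ⊕ v′ · x′  ≡⟨ cong (_⊕ v′ · x′) (·-comm v′ x) ⟩
      x · v′ ⊕ v′ · x′  ∎

  eqH-refl : ∀ {n} (h : H q n) → T (eqH F h h)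
  eqH-refl (x , y , z) = T-∧⁺ (fromWitness {a? = x ≟V x} refl)
    (T-∧⁺ (fromWitness {a? = y ≟V y} refl) (fromWitness {a? = z ≟F z} refl))

  -- Collisions among products of elements of [E, E, 0].

  module _ {n : ℕ} (E : SubsetV q n) where

    private
      V = allVecs q n
      xs = filterᵇ E V
      xs² = cartesianProduct xs xs

      -- The coordinates of a pair of elements [x, y, 0], [x′, y′, 0] of [E, E, 0],
      -- listed as x, y′, (y, x′).
      quadruples = cartesianProduct xs (cartesianProduct xs xs²)

      -- The last two coordinates form an element of `xs²`: for two colliding quadruples these are
      -- the points p and p′, while w takes x from one and v′ from the other.
      product : Vec (Fin q) n × Vec (Fin q) n × Vec (Fin q) n × Vec (Fin q) n → H q n
      product (x , y′ , y , x′) = hmul F (x , y , 0#) (x′ , y′ , 0#)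

    xs-nonrepeating : Nonrepeating _≟V_ xs
    xs-nonrepeating = ⊆-nonrepeating _≟V_ (allVecs-enumerates q n) (filterᵇ-⊆ E V)

    -- The vector coordinates force y′ = v + v′ - y and u = x + x′ - u′, so at most one pair (y′, u)
    -- contributes, and only when the reduced equation holds.
    product-collisions-fibre : ∀ (x v′ v u′ y x′ : Vec (Fin q) n) →
      ∑[ y′ ∈ xs ] ∑[ u ∈ xs ] 𝟙 (does (product (x , y′ , y , x′) ≟H product (u , v′ , v , u′)))
        ≤ 𝟙 (does ((x , v′) ⋆ (v , u′) ≟F (x , v′) ⋆ (y , x′)))
    product-collisions-fibre x v′ v u′ y x′ = begin
      ∑[ y′ ∈ xs ] ∑[ u ∈ xs ] 𝟙 (does (product (x , y′ , y , x′) ≟H product (u , v′ , v , u′)))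
        ≤⟨ ∑-mono xs (λ y′ → ∑-mono xs (λ u → term y′ u)) ⟩
      ∑[ y′ ∈ xs ] ∑[ u ∈ xs ] (c * 𝟙 (does (y₀ ≟V y′)) * 𝟙 (does (u₀ ≟V u)))
        ≡⟨ ∑-* xs xs _ _ ⟩
      ∑[ y′ ∈ xs ] (c * 𝟙 (does (y₀ ≟V y′))) * occurrences _≟V_ u₀ xs
        ≡⟨ cong (_* occurrences _≟V_ u₀ xs) (∑-*ˡ xs c _) ⟩
      c * occurrences _≟V_ y₀ xs * occurrences _≟V_ u₀ xs
        ≤⟨ *-mono-≤ (*-monoʳ-≤ c (xs-nonrepeating y₀)) (xs-nonrepeating u₀) ⟩
      c * 1 * 1
        ≡⟨ trans (*-identityʳ (c * 1)) (*-identityʳ c) ⟩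
      c ∎
      where
      open ≤-Reasoning
      c? = (x , v′) ⋆ (v , u′) ≟F (x , v′) ⋆ (y , x′)
      c = 𝟙 (does c?)
      y₀ = v ⊞ v′ ⊟ y
      u₀ = x ⊞ x′ ⊟ u′
      term : ∀ y′ u → 𝟙 (does (product (x , y′ , y , x′) ≟H product (u , v′ , v , u′)))
                    ≤ c * 𝟙 (does (y₀ ≟V y′)) * 𝟙 (does (u₀ ≟V u))
      term y′ u = ≤-trans
        (𝟙-mono (product (x , y′ , y , x′) ≟H product (u , v′ , v , u′)) ((c? ×-dec (y₀ ≟V y′)) ×-dec (u₀ ≟V u)) solve)
        (≤-reflexive (trans (𝟙-∧ (does c? ∧ does (y₀ ≟V y′)) _) (cong (_* 𝟙 (does (u₀ ≟V u))) (𝟙-∧ (does c?) _))))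
        where
        solve : product (x , y′ , y , x′) ≡ product (u , v′ , v , u′) →
                ((x , v′) ⋆ (v , u′) ≡ (x , v′) ⋆ (y , x′) × y₀ ≡ y′) × u₀ ≡ u
        solve eq = (product-collision {x = x} {x′} {y} {y′} {u} {u′} {v} {v′} xx′≡uu′ yy′≡vv′ xy′≡uv′
                   , trans (cong (_⊟ y) (trans (sym yy′≡vv′) (⊞-comm y y′))) (x⊞y⊟y y′ y))
                   , trans (cong (_⊟ u′) xx′≡uu′) (x⊞y⊟y u u′)
          where
          xx′≡uu′ : x ⊞ x′ ≡ u ⊞ u′
          xx′≡uu′ = cong proj₁ eq
          yy′≡vv′ : y ⊞ y′ ≡ v ⊞ v′
          yy′≡vv′ = cong (proj₁ ∘ proj₂) eq
          -- The last coordinate of each product is `0# ⊕ 0#` plus a dot product.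
          xy′≡uv′ : x · y′ ≡ u · v′
          xy′≡uv′ = ∙-cancelˡ (0# ⊕ 0#) _ _ (cong (proj₂ ∘ proj₂) eq)

    -- Move the sums over y′ and u innermost, bound them fibrewise, and regroup the remaining six
    -- variables as w = (x , v′), p and p′.
    product-collisions≤ : collisions _≟H_ quadruples product ≤ ∑[ w ∈ xs² ] collisions _≟F_ xs² (w ⋆_)
    product-collisions≤ = begin
      ∑[ i ∈ quadruples ] ∑[ j ∈ quadruples ] δ i j
        ≡⟨ trans (∑-× xs J _) (∑-cong (λ x → trans (∑-× xs xs² _) (∑-cong (λ y′ → ∑-cong (λ p′ →
             ∑-× xs J _) xs²) xs)) xs) ⟩
      ∑[ x ∈ xs ] ∑[ y′ ∈ xs ] ∑[ p′ ∈ xs² ] ∑[ u ∈ xs ] ∑[ r ∈ J ] δ (x , y′ , p′) (u , r)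
        ≡⟨ ∑-cong (λ x → reorder (λ y′ p′ u r → δ (x , y′ , p′) (u , r))) xs ⟩
      ∑[ x ∈ xs ] ∑[ r ∈ J ] ∑[ p′ ∈ xs² ] ∑[ y′ ∈ xs ] ∑[ u ∈ xs ] δ (x , y′ , p′) (u , r)
        ≤⟨ ∑-mono xs (λ x → ∑-mono J (λ { (v′ , v , u′) → ∑-mono xs² (λ { (y , x′) →
             product-collisions-fibre x v′ v u′ y x′ }) })) ⟩
      ∑[ x ∈ xs ] ∑[ r ∈ J ] ∑[ p′ ∈ xs² ] 𝟙 (does ((x , proj₁ r) ⋆ proj₂ r ≟F (x , proj₁ r) ⋆ p′))
        ≡⟨ ∑-cong (λ x → ∑-× xs xs² _) xs ⟩
      ∑[ x ∈ xs ] ∑[ v′ ∈ xs ] collisions _≟F_ xs² ((x , v′) ⋆_)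
        ≡⟨ ∑-× xs xs _ ⟨
      ∑[ w ∈ xs² ] collisions _≟F_ xs² (w ⋆_) ∎
      where
      open ≤-Reasoning
      J = cartesianProduct xs xs²
      δ : ∀ (i j : Vec (Fin q) n × Vec (Fin q) n × Vec (Fin q) n × Vec (Fin q) n) → ℕ
      δ i j = 𝟙 (does (product i ≟H product j))
      reorder : ∀ (f : Vec (Fin q) n → Vec (Fin q) n × Vec (Fin q) n → Vec (Fin q) n →
                       Vec (Fin q) n × Vec (Fin q) n × Vec (Fin q) n → ℕ) →
        ∑[ y′ ∈ xs ] ∑[ p′ ∈ xs² ] ∑[ u ∈ xs ] ∑[ r ∈ J ] f y′ p′ u r
          ≡ ∑[ r ∈ J ] ∑[ p′ ∈ xs² ] ∑[ y′ ∈ xs ] ∑[ u ∈ xs ] f y′ p′ u r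
      reorder f = trans
        (∑-cong (λ y′ → trans (∑-cong (λ p′ → ∑-swap xs J (f y′ p′)) xs²)
          (∑-swap xs² J (λ p′ r → ∑[ u ∈ xs ] f y′ p′ u r))) xs)
        (trans (∑-swap xs J (λ y′ r → ∑[ p′ ∈ xs² ] ∑[ u ∈ xs ] f y′ p′ u r))
          (∑-cong (λ r → ∑-swap xs xs² (λ y′ p′ → ∑[ u ∈ xs ] f y′ p′ u r)) J))

    -- Membership in the product set and the final count.

    ∈xs⇒T : ∀ {x} → x ∈ xs → T (E x)
    ∈xs⇒T x∈ = proj₂ (∈-filter⁻ (T? ∘ E) {xs = V} x∈)

    inEE0-complete : ∀ {x y} → T (E x) → T (E y) → T (inEE0 F E (x , y , 0#))
    inEE0-complete {x} {y} Ex Ey = T-∧⁺ Ex (T-∧⁺ Ey (fromWitness {a? = 0# ≟F 0#} refl))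

    inEE0EE0-complete : ∀ m m′ → T (inEE0 F E m) → T (inEE0 F E m′) → T (inEE0EE0 F E (hmul F m m′))
    inEE0EE0-complete m m′ m∈ m′∈ = any⁺ _ (lose (∈-allH m) (T-∧⁺ m∈
      (any⁺ _ (lose (∈-allH m′) (T-∧⁺ m′∈ (eqH-refl (hmul F m m′)))))))

    -- Ensures that filtering by the product set keeps every value of `product`, as the
    -- Cauchy-Schwarz bound requires.
    product-∈ : ∀ {i} → i ∈ quadruples → T (inEE0EE0 F E (product i))
    product-∈ {x , y′ , y , x′} i∈ =
      let x∈ , i∈′    = ∈-cartesianProduct⁻ xs (cartesianProduct xs xs²) i∈
          y′∈ , p∈    = ∈-cartesianProduct⁻ xs xs² i∈′
          y∈ , x′∈    = ∈-cartesianProduct⁻ xs xs p∈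
      in inEE0EE0-complete (x , y , 0#) (x′ , y′ , 0#)
           (inEE0-complete (∈xs⇒T x∈) (∈xs⇒T y∈)) (inEE0-complete (∈xs⇒T x′∈) (∈xs⇒T y′∈))

    -- The indicator of [E, E, 0] factors over the coordinates, and the last factor selects the
    -- single value `0#`.
    cardEE0≡card² : cardEE0 F E ≡ card E * card E
    cardEE0≡card² = begin
      cardEE0 F E
        ≡⟨ length-filterᵇ (inEE0 F E) (allH q n) ⟩
      ∑ (allH q n) (𝟙 ∘ inEE0 F E)
        ≡⟨ ∑-cong split (allH q n) ⟩
      ∑ (allH q n) (λ (x , y , z) → 𝟙 (E x) * (𝟙 (E y) * 𝟙 (does (0# ≟F z))))
        ≡⟨ ∑-allH-* q n _ _ _ ⟩
      ∑ V (𝟙 ∘ E) * (∑ V (𝟙 ∘ E) * occurrences _≟F_ 0# (allFin q))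
        ≡⟨ cong (λ o → ∑ V (𝟙 ∘ E) * (∑ V (𝟙 ∘ E) * o)) (allFin-enumerates q 0#) ⟩
      ∑ V (𝟙 ∘ E) * (∑ V (𝟙 ∘ E) * 1)
        ≡⟨ cong (∑ V (𝟙 ∘ E) *_) (*-identityʳ _) ⟩
      ∑ V (𝟙 ∘ E) * ∑ V (𝟙 ∘ E)
        ≡⟨ cong₂ _*_ (length-filterᵇ E V) (length-filterᵇ E V) ⟨
      card E * card E ∎
      where
      open ≡-Reasoning
      split : ∀ ((x , y , z) : H q n) → 𝟙 (inEE0 F E (x , y , z)) ≡ 𝟙 (E x) * (𝟙 (E y) * 𝟙 (does (0# ≟F z)))
      split (x , y , z) = trans (𝟙-∧ (E x) _) (cong (𝟙 (E x) *_) (trans (𝟙-∧ (E y) _) (cong (𝟙 (E y) *_)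
        (trans (cong 𝟙 (isYes≗does (z ≟F 0#))) (𝟙-cong (z ≟F 0#) (0# ≟F z) sym sym)))))

    -- With N the size of the product set and T the number of collisions, e⁸ ≤ N T and q T ≤ 2 e⁶.
    -- Hence q e⁸ ≤ 2 N e⁶, and e⁶ cancels.
    cardEE0EE0-bound : let e = card E in
      q * (q ^ n * q ^ n) ≤ e * e * (e * e) → q * cardEE0 F E ≤ 2 * cardEE0EE0 F E
    cardEE0EE0-bound large = ≤-trans (≤-reflexive (cong (q *_) cardEE0≡card²)) (cancel e² refl)
      where
      open ≤-Reasoning
      e² = card E * card E
      length-xs² : length xs² ≡ e²
      length-xs² = length-cartesianProduct xs xs
      length-quadruples : length quadruples ≡ e² * e²
      length-quadruples = begin-equality
        length quadruples            ≡⟨ length-cartesianProduct xs _ ⟩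
        card E * length (cartesianProduct xs xs²) ≡⟨ cong (card E *_) (length-cartesianProduct xs xs²) ⟩
        card E * (card E * length xs²) ≡⟨ cong (λ l → card E * (card E * l)) length-xs² ⟩
        card E * (card E * e²)       ≡⟨ *-assoc (card E) (card E) e² ⟨
        e² * e²                      ∎
      energy : q * collisions _≟H_ quadruples product ≤ 2 * (e² * (e² * e²))
      energy = begin
        q * collisions _≟H_ quadruples product
          ≤⟨ *-monoʳ-≤ q product-collisions≤ ⟩
        q * ∑[ w ∈ xs² ] collisions _≟F_ xs² (w ⋆_)
          ≤⟨ restricted-pencil-collisions xs² (×-nonrepeating xs xs xs-nonrepeating xs-nonrepeating)
               (cartesianProduct-⊆ (filterᵇ-⊆ E V) (filterᵇ-⊆ E V)) ⟩
        q * (q ^ n * q ^ n) * length xs² + length xs² * (length xs² * length xs²)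
          ≡⟨ cong (λ l → q * (q ^ n * q ^ n) * l + l * (l * l)) length-xs² ⟩
        q * (q ^ n * q ^ n) * e² + e² * (e² * e²)
          -- The size hypothesis makes the error term at most the main term e⁶.
          ≤⟨ +-monoˡ-≤ _ (*-monoˡ-≤ e² large) ⟩
        e² * e² * e² + e² * (e² * e²)
          ≡⟨ double e² ⟩
        2 * (e² * (e² * e²)) ∎
        where
        double : ∀ m → m * m * m + m * (m * m) ≡ 2 * (m * (m * m))
        double = solve-∀
      key : e² * (e² * e²) * (q * e²) ≤ e² * (e² * e²) * (2 * cardEE0EE0 F E)
      key = begin
        e² * (e² * e²) * (q * e²)
          ≡⟨ lhs e² q ⟩
        q * ((e² * e²) * (e² * e²))
          ≡⟨ cong (λ l → q * (l * l)) length-quadruples ⟨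
        q * (length quadruples * length quadruples)
          ≤⟨ *-monoʳ-≤ q (∣xs∣²≤∣ks∣*collisions _≟H_ quadruples product (filterᵇ (inEE0EE0 F E) (allH q n))
               (λ {i} i∈ → trans (occurrences-filterᵇ _≟H_ (inEE0EE0 F E) (product i) (allH q n) (product-∈ i∈))
                                 (allH-enumerates q n (product i)))) ⟩
        q * (cardEE0EE0 F E * collisions _≟H_ quadruples product)
          ≡⟨ mid q (cardEE0EE0 F E) _ ⟩
        cardEE0EE0 F E * (q * collisions _≟H_ quadruples product)
          ≤⟨ *-monoʳ-≤ (cardEE0EE0 F E) energy ⟩
        cardEE0EE0 F E * (2 * (e² * (e² * e²)))
          ≡⟨ rhs (cardEE0EE0 F E) (e² * (e² * e²)) ⟩
        e² * (e² * e²) * (2 * cardEE0EE0 F E) ∎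
        where
        lhs : ∀ m q → m * (m * m) * (q * m) ≡ q * ((m * m) * (m * m))
        lhs = solve-∀
        mid : ∀ a b c → a * (b * c) ≡ b * (a * c)
        mid = solve-∀
        rhs : ∀ a b → a * (2 * b) ≡ b * (2 * a)
        rhs = solve-∀
      -- Cancelling e⁶ requires E to be nonempty; for empty E the left side is zero.
      cancel : ∀ m → e² ≡ m → q * e² ≤ 2 * cardEE0EE0 F E
      cancel zero    e²≡0 = ≤-trans (≤-reflexive (trans (cong (q *_) e²≡0) (*-zeroʳ q))) z≤n
      cancel (suc m) e²≡  = *-cancelˡ-≤ (suc m * (suc m * suc m))
        (subst (λ l → l * (l * l) * (q * e²) ≤ l * (l * l) * (2 * cardEE0EE0 F E)) e²≡ key)

theorem1p6 : (n : ℕ) → n ≥ 1 → ∃ λ (C : ℕ) → ∃ λ (c : ℕ) → (c ≥ 1) ×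
    ((q : ℕ) (F : FiniteField q) (E : SubsetV q n) →
    C ^ 4 * q ^ (2 * n + 1) ≤ card E ^ 4 →
    q * cardEE0 F E ≤ c * cardEE0EE0 F E)
-- With C = 1 the hypothesis is the fourth power of |E| ≥ q^(n/2 + 1/4). The constant 2 comes from
-- the two terms bounding q T, each at most |E|⁶.
theorem1p6 n n≥1 = 1 , 2 , s≤s z≤n , λ q F E large → cardEE0EE0-bound F E (begin
  q * (q ^ n * q ^ n)                       ≡⟨ *-comm q _ ⟩
  q ^ n * q ^ n * q                         ≡⟨ cong (_* q) (^-distribˡ-+-* q n n) ⟨
  q ^ (n + n) * q                           ≡⟨ cong₂ (λ k r → q ^ (n + k) * r) (+-identityʳ n) (^-identityʳ q) ⟨
  q ^ (2 * n) * q ^ 1                       ≡⟨ ^-distribˡ-+-* q (2 * n) 1 ⟨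
  q ^ (2 * n + 1)                           ≡⟨ *-identityˡ _ ⟨
  1 ^ 4 * q ^ (2 * n + 1)                   ≤⟨ large ⟩
  card E ^ 4                                ≡⟨ fourth (card E) ⟩
  card E * card E * (card E * card E)       ∎)
  where
  open ≤-Reasoning
  fourth : ∀ m → m ^ 4 ≡ m * m * (m * m)
  fourth m = trans (^-distribˡ-+-* m 2 2) (cong (λ k → m * k * (m * k)) (*-identityʳ m))
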